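{- Let $G$ be an edge-coloured graph on $n$ vertices. If either of the conditions below is satisfied, then $G$ has a rainbow triangle. (1) There are at least $\frac{9}{8}n$ colour classes, each of size at least $\frac{n}{3}$. (2) There are at least $n$ colour classes, each of size at least $\frac{2n}{5}$.
   Context: Graphs are finite, undirected and simple, with at least one vertex. An edge-coloured graph is a graph $G=(V,E)$ equipped with a distinguished partition $\{C_1,\ldots,C_p\}$ of $E$ (into nonempty parts); the sets $C_i$ are called colour classes, the indices $i$ are called colours, and an edge $e$ has colour $i$ if $e\in C_i$. (The colouring need not be proper.) The size of a colour class is its number of edges. A subgraph $H$ of $G$ is rainbow if distinct edges of $H$ have distinct colours. A triangle is a subgraph isomorphic to $K_3$. -}

module Defs where

open import Data.Fin using (Fin; _<_)
open import Data.Fin.Properties using (_≟_)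
open import Data.Fin.Subset using (Subset; _∈_; ∣_∣)
open import Data.List using (length; filter; cartesianProduct; allFin)
open import Data.Nat using (ℕ; _*_; _≤_)
open import Data.Product using (_×_; _,_; ∃; proj₁; Σ-syntax)
open import Function.Bundles using (_↔_; _⇔_; Inverse)
open import Level using (0ℓ)
open import Relation.Binary.Core using (Rel)
open import Relation.Binary.Definitions using (Symmetric; Irreflexive; Decidable)
open import Relation.Binary.PropositionalEquality using (_≡_; _≢_; refl; sym)
open import Relation.Nullary using (¬?)
open import Relation.Unary as U using (Pred; Satisfiable)

-- Adjacency is decidable, as is automatic classically; this makes edges countable.
record Graph (V : Set) : Set₁ where
  field
    _~_      : Rel V 0ℓ
    ~-sym    : Symmetric _~_
    ~-irrefl : Irreflexive _≡_ _~_
    _~?_     : Decidable _~_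

complete : ∀ n → Graph (Fin n)
complete n = record
  { _~_      = _≢_
  ; ~-sym    = λ u≢v v≡u → u≢v (sym v≡u)
  ; ~-irrefl = λ u≡v u≢v → u≢v u≡v
  ; _~?_     = λ u v → ¬? (u ≟ v)
  }

record _≅_ {V W : Set} (G : Graph V) (H : Graph W) : Set where
  private
    module G = Graph G
    module H = Graph H
  field
    bijection : V ↔ W
    adjacency : ∀ u v → (u G.~ v) ⇔ (Inverse.to bijection u H.~ Inverse.to bijection v)

-- The undirected edge {u , v} is represented once, by its pair (u , v) with u < v,
-- so distinct pairs in E G are distinct edges.
E : ∀ {n} → Graph (Fin n) → Pred (Fin n × Fin n) 0ℓ
E G (u , v) = u < v × u ~ v
  where open Graph G

-- Decidability of the classes follows from the other fields, so it is no restriction.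
record EdgeColouredGraph (n : ℕ) : Set₁ where
  field
    graph    : Graph (Fin n)
    p        : ℕ
    C        : Fin p → Pred (Fin n × Fin n) 0ℓ
    C?       : ∀ i → U.Decidable (C i)
    C⊆E      : ∀ i → C i U.⊆ E graph
    nonempty : ∀ i → Satisfiable (C i)
    disjoint : ∀ {i j e} → C i e → C j e → i ≡ j
    cover    : ∀ {e} → E graph e → ∃ λ i → C i e

  size : Fin p → ℕ
  size i = length (filter (C? i) (cartesianProduct (allFin n) (allFin n)))

-- `edges` lives on the ambient vertex set, so that edges of a subgraph are
-- literally edges of G; `endpoints` confines them to `vertices`, the other endpoint
-- being covered by symmetry.
record Subgraph {n} (G : Graph (Fin n)) : Set₁ where
  field
    vertices : Subset n
    edges    : Graph (Fin n)

  open Graph edges public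

  field
    endpoints : ∀ {u v} → u ~ v → u ∈ vertices
    edges⊆    : ∀ {u v} → u ~ v → Graph._~_ G u v

  asGraph : Graph (∃ λ v → v ∈ vertices)
  asGraph = record
    { _~_      = λ u v → proj₁ u ~ proj₁ v
    ; ~-sym    = ~-sym
    ; ~-irrefl = λ { refl → ~-irrefl refl }
    ; _~?_     = λ u v → proj₁ u ~? proj₁ v
    }

IsTriangle : ∀ {n} {G : Graph (Fin n)} → Subgraph G → Set
IsTriangle H = Subgraph.asGraph H ≅ complete 3

module _ {n} (G : EdgeColouredGraph n) where
  open EdgeColouredGraph G

  IsRainbow : Subgraph graph → Set
  IsRainbow H = ∀ {e f i j} → E edges e → E edges f → e ≢ f → C i e → C j f → i ≢ j
    where open Subgraph H using (edges)

  HasRainbowTriangle : Set₁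
  HasRainbowTriangle = Σ[ H ∈ Subgraph graph ] IsTriangle H × IsRainbow H

  -- At least (a / b) n colour classes, each of size at least (c / d) n, with
  -- denominators cleared. Classes outside I may have any size.
  -- Only meaningful for b and d positive.
  ManyLargeClasses : (a b c d : ℕ) → Set
  ManyLargeClasses a b c d =
    Σ[ I ∈ Subset p ] (a * n ≤ b * ∣ I ∣) × (∀ i → i ∈ I → c * n ≤ d * size i)

{-# OPTIONS --safe #-}

-- Discard all but k edges from each large class and all edges of the other classes,
-- where k is the least integer that is at least n/3, respectively 2n/5. With q large
-- classes, m = qk edges remain. By Goodman's bound they span at least m(4m − n²)/3n
-- triangles. If none of these is rainbow, each contains two adjacent edges of the same
-- colour, so there are at most q · k(k − 1)/2 of them. Comparing the two bounds gives
-- 8qk + 3n ≤ 2n² + 3nk, contrary to either hypothesis.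

module Submission where

open import Defs
open import Data.Bool using (if_then_else_; true; false)
open import Data.Fin as Fin using (Fin; zero; suc; inject≤)
open import Data.Fin.Patterns using (0F; 1F; 2F)
import Data.Fin.Properties as Fin
open import Data.Fin.Subset using (Subset; _∈_; ∣_∣; ⁅_⁆; _∪_)
open import Data.Fin.Subset.Properties using (_∈?_; x∈⁅x⁆; x∈⁅y⁆⇒x≡y; x∈p∪q⁺; x∈p∪q⁻)
open import Data.List as List using (List; filter; cartesianProduct; allFin)
open import Data.List.Membership.Propositional.Properties using (∈-lookup; ∈-filter⁻)
import Data.List.Relation.Unary.All as All
open import Data.List.Relation.Unary.AllPairs using (_∷_)
open import Data.List.Relation.Unary.Unique.Propositional using (Unique)
import Data.List.Relation.Unary.Unique.Propositional.Properties as Unique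
open import Data.Nat
  using (ℕ; zero; suc; _+_; _*_; _≤_; _<_; z≤n; s≤s; z<s; _≤?_; NonZero; >-nonZero; >-nonZero⁻¹)
open import Data.Nat.Properties
open import Data.Nat.Tactic.RingSolver using (solve-∀)
open import Data.Product using (_×_; _,_; ∃; proj₁; proj₂)
open import Data.Sum using (_⊎_; inj₁; inj₂)
open import Data.Vec using ([]; _∷_; lookup)
open import Data.Vec.Properties using (lookup⇒[]=)
open import Data.Vec.Properties.WithK using ([]=-irrelevant)
open import Function using (_∘_)
open import Function.Bundles using (mk↔ₛ′; mk⇔)
open import Function.Definitions using (Injective)
open import Relation.Binary.PropositionalEquality
open import Relation.Nullary using (¬_; Dec; yes; no; ¬?; contradiction)
open import Relation.Nullary.Decidable using (from-yes; decidable-stable; _×-dec_; _⊎-dec_; _→-dec_)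
open import Algebra.Properties.Semiring.Sum +-*-semiring
  using (sum; sum-syntax; sum-cong-≗; ∑-distrib-+; ∑-comm; *-distribˡ-sum; *-distribʳ-sum)

-- Arithmetic of natural numbers, with 0/1 values as truth values.

-- Positivity plays the part of truth here: this is the disjointness argument behind every later
-- proof that a sum of indicators is an indicator.
exclusive : ∀ {m k} → m ≤ 1 → k ≤ 1 → (0 < m → ¬ 0 < k) → m + k ≤ 1
exclusive {zero}  {k}     _   k≤1 _   = k≤1
exclusive {suc m} {zero}  m≤1 _   _   = subst (_≤ 1) (sym (+-identityʳ (suc m))) m≤1
exclusive {suc m} {suc k} _   _   m#k = contradiction z<s (m#k z<s)

0<m+k⇒ : ∀ m {k} → 0 < m + k → 0 < m ⊎ 0 < k
0<m+k⇒ zero    0<k = inj₂ 0<k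
0<m+k⇒ (suc m) _   = inj₁ z<s

0<m*k⇒ : ∀ m {k} → 0 < m * k → 0 < m × 0 < k
0<m*k⇒ (suc m) {suc k} _ = z<s , z<s
0<m*k⇒ (suc m) {zero}  h = contradiction (subst (0 <_) (*-zeroʳ m) h) λ ()

-- This is the integer ceiling of m/d. Leastness turns a lower bound m/d on the size of a class into
-- the integer bound k, so that exactly k edges can be kept.
ceiling : ∀ d .{{_ : NonZero d}} m → ∃ λ k → m ≤ d * k × (∀ s → m ≤ d * s → k ≤ s)
ceiling d zero    = 0 , z≤n , λ _ _ → z≤n
ceiling d (suc m) with ceiling d m
... | k , m≤dk , least with suc m ≤? d * k
...   | yes m<dk = k , m<dk , λ s m<ds → least s (<⇒≤ m<ds)
...   | no  m≮dk = suc k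
  , subst (suc m ≤_) (sym (*-suc d k)) (+-mono-≤ (>-nonZero⁻¹ d) m≤dk)
  -- The old least value k is now too small, so `s` must exceed it.
  , λ s m<ds → ≤∧≢⇒< (least s (<⇒≤ m<ds)) λ { refl → m≮dk m<ds }

0<⇒1≤⇒≤ : ∀ {m k} → m ≤ 1 → (0 < m → 1 ≤ k) → m ≤ k
0<⇒1≤⇒≤ {zero}  _       _ = z≤n
0<⇒1≤⇒≤ {suc _} (s≤s z≤n) h = h z<s

-- This is (1 - b)(1 - c) ≥ 0, written without subtraction.
b+c≤1+cb : ∀ {b c} → b ≤ 1 → c ≤ 1 → b + c ≤ 1 + c * b
b+c≤1+cb {zero}  {c} _         c≤1 = ≤-trans c≤1 (m≤m+n 1 _)
b+c≤1+cb {suc _} {c} (s≤s z≤n) _   = s≤s (≤-reflexive (sym (*-identityʳ c)))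

-- The defect is the square of the difference `o` of the larger and the smaller number.
2mn≤m²+n² : ∀ m n → 2 * (m * n) ≤ m * m + n * n
2mn≤m²+n² m n with ≤-total m n
... | inj₁ m≤n with m≤n⇒∃[o]m+o≡n m≤n
...   | o , refl = subst (2 * (m * (m + o)) ≤_) (identity m o) (m≤m+n _ (o * o))
  where identity : ∀ m o → 2 * (m * (m + o)) + o * o ≡ m * m + (m + o) * (m + o)
        identity = solve-∀
2mn≤m²+n² m n | inj₂ n≤m with m≤n⇒∃[o]m+o≡n n≤m
...   | o , refl = subst (2 * ((n + o) * n) ≤_) (identity n o) (m≤m+n _ (o * o))
  where identity : ∀ n o → 2 * ((n + o) * n) + o * o ≡ (n + o) * (n + o) + n * n
        identity = solve-∀

lookup-injective : ∀ {A : Set} {xs : List A} → Unique xs → Injective _≡_ _≡_ (List.lookup xs)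
lookup-injective (_ ∷ _)   {zero}  {zero}  _  = refl
lookup-injective (x∉ ∷ _)  {zero}  {suc j} eq = contradiction eq (All.lookup x∉ (∈-lookup j))
lookup-injective (x∉ ∷ _)  {suc i} {zero}  eq = contradiction (sym eq) (All.lookup x∉ (∈-lookup i))
lookup-injective (_ ∷ xs!) {suc i} {suc j} eq = cong suc (lookup-injective xs! eq)

-- Finite sums, the Kronecker delta and triple sums.

sum-mono-≤ : ∀ {n} {f g : Fin n → ℕ} → (∀ i → f i ≤ g i) → sum f ≤ sum g
sum-mono-≤ {zero}  f≤g = z≤n
sum-mono-≤ {suc n} f≤g = +-mono-≤ (f≤g zero) (sum-mono-≤ λ i → f≤g (suc i))

sum-const : ∀ n c → ∑[ i < n ] c ≡ n * c
sum-const zero    c = refl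
sum-const (suc n) c = cong (c +_) (sum-const n c)

term≤sum : ∀ {n} (f : Fin n → ℕ) i → f i ≤ sum f
term≤sum f zero    = m≤m+n (f zero) _
term≤sum f (suc i) = ≤-trans (term≤sum (λ j → f (suc j)) i) (m≤n+m _ (f zero))

0<sum⇒∃ : ∀ {n} (f : Fin n → ℕ) → 0 < sum f → ∃ λ i → 0 < f i
0<sum⇒∃ {suc n} f 0<Σ with f zero in eq
... | suc m = zero , subst (0 <_) (sym eq) z<s
... | zero  with 0<sum⇒∃ (λ j → f (suc j)) 0<Σ
...   | i , 0<fi = suc i , 0<fi

sum≤1 : ∀ {n} (f : Fin n → ℕ) → (∀ i → f i ≤ 1) →
        (∀ i j → 0 < f i → 0 < f j → i ≡ j) → sum f ≤ 1
sum≤1 {zero}  f f≤1 unique = z≤n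
sum≤1 {suc n} f f≤1 unique = exclusive (f≤1 zero)
  (sum≤1 (λ j → f (suc j)) (λ j → f≤1 (suc j)) λ i j 0<fi 0<fj →
    Fin.suc-injective (unique (suc i) (suc j) 0<fi 0<fj))
  λ 0<f₀ 0<rest → let j , 0<fj = 0<sum⇒∃ (λ j → f (suc j)) 0<rest
                  in contradiction (unique zero (suc j) 0<f₀ 0<fj) λ ()

sum-indicator : ∀ {p} (I : Subset p) k → ∑[ i < p ] (if lookup I i then k else 0) ≡ ∣ I ∣ * k
sum-indicator []          k = refl
sum-indicator (true  ∷ I) k = cong (k +_) (sum-indicator I k)
sum-indicator (false ∷ I) k = sum-indicator I k

δ : ∀ {n} → Fin n → Fin n → ℕ
δ zero    zero    = 1
δ zero    (suc _) = 0
δ (suc _) zero    = 0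
δ (suc u) (suc v) = δ u v

δ-refl : ∀ {n} (u : Fin n) → δ u u ≡ 1
δ-refl zero    = refl
δ-refl (suc u) = δ-refl u

δ≤1 : ∀ {n} (u v : Fin n) → δ u v ≤ 1
δ≤1 zero    zero    = ≤-refl
δ≤1 zero    (suc _) = z≤n
δ≤1 (suc _) zero    = z≤n
δ≤1 (suc u) (suc v) = δ≤1 u v

0<δ⇒≡ : ∀ {n} {u v : Fin n} → 0 < δ u v → u ≡ v
0<δ⇒≡ {u = zero}  {zero}  _   = refl
0<δ⇒≡ {u = suc _} {suc _} 0<δ = cong suc (0<δ⇒≡ 0<δ)

∑-δ : ∀ {n} (u : Fin n) (f : Fin n → ℕ) → ∑[ v < n ] (δ u v * f v) ≡ f u
∑-δ {suc n} zero    f = trans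
  (cong₂ _+_ (*-identityˡ (f zero)) (trans (sum-const n 0) (*-zeroʳ n))) (+-identityʳ _)
∑-δ {suc n} (suc u) f = ∑-δ u (λ v → f (suc v))

-- Cauchy-Schwarz against the constant vector. Doubling both sides lets `2mn≤m²+n²` be applied to
-- each pair (i, j) of the expanded square.
sum²≤n*sum-squares : ∀ {n} (f : Fin n → ℕ) → sum f * sum f ≤ n * ∑[ i < n ] (f i * f i)
sum²≤n*sum-squares {n} f = *-cancelˡ-≤ 2 (begin
  2 * (sum f * sum f)                                   ≡⟨ cong (2 *_) (*-distribʳ-sum (sum f) f) ⟩
  2 * ∑[ i < n ] (f i * sum f)                          ≡⟨ *-distribˡ-sum 2 (λ i → f i * sum f) ⟩
  ∑[ i < n ] (2 * (f i * sum f))                        ≡⟨ sum-cong-≗ (λ i → trans (cong (2 *_) (*-distribˡ-sum (f i) f)) (*-distribˡ-sum 2 (λ j → f i * f j))) ⟩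
  ∑[ i < n ] ∑[ j < n ] (2 * (f i * f j))               ≤⟨ sum-mono-≤ (λ i → sum-mono-≤ λ j → 2mn≤m²+n² (f i) (f j)) ⟩
  ∑[ i < n ] ∑[ j < n ] (f i * f i + f j * f j)         ≡⟨ sum-cong-≗ (λ i → trans (∑-distrib-+ (λ _ → f i * f i) (λ j → f j * f j)) (cong (_+ Q) (sum-const n (f i * f i)))) ⟩
  ∑[ i < n ] (n * (f i * f i) + Q)                      ≡⟨ ∑-distrib-+ (λ i → n * (f i * f i)) (λ _ → Q) ⟩
  ∑[ i < n ] (n * (f i * f i)) + ∑[ i < n ] Q           ≡⟨ cong₂ _+_ (sym (*-distribˡ-sum n (λ i → f i * f i))) (sum-const n Q) ⟩
  n * Q + n * Q                                         ≡⟨ cong (n * Q +_) (sym (+-identityʳ (n * Q))) ⟩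
  2 * (n * Q)                                           ∎)
  where
  open ≤-Reasoning
  Q = ∑[ i < n ] (f i * f i)

∑³ : ∀ {n} → (Fin n → Fin n → Fin n → ℕ) → ℕ
∑³ {n} f = ∑[ u < n ] ∑[ v < n ] ∑[ w < n ] f u v w

module _ {n : ℕ} where

  ∑³-mono-≤ : {f g : Fin n → Fin n → Fin n → ℕ} → (∀ u v w → f u v w ≤ g u v w) → ∑³ f ≤ ∑³ g
  ∑³-mono-≤ f≤g = sum-mono-≤ λ u → sum-mono-≤ λ v → sum-mono-≤ λ w → f≤g u v w

  ∑³-cong : {f g : Fin n → Fin n → Fin n → ℕ} → (∀ u v w → f u v w ≡ g u v w) → ∑³ f ≡ ∑³ g
  ∑³-cong f≡g = sum-cong-≗ λ u → sum-cong-≗ λ v → sum-cong-≗ λ w → f≡g u v w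

  ∑³-distrib-+ : (f g : Fin n → Fin n → Fin n → ℕ) →
                 ∑³ (λ u v w → f u v w + g u v w) ≡ ∑³ f + ∑³ g
  ∑³-distrib-+ f g = trans
    (sum-cong-≗ λ u → trans
      (sum-cong-≗ λ v → ∑-distrib-+ (f u v) (g u v))
      (∑-distrib-+ (λ v → sum (f u v)) (λ v → sum (g u v))))
    (∑-distrib-+ (λ u → ∑[ v < n ] sum (f u v)) (λ u → ∑[ v < n ] sum (g u v)))

  ∑³-rotate : (f : Fin n → Fin n → Fin n → ℕ) → ∑³ (λ u v w → f v w u) ≡ ∑³ f
  ∑³-rotate f = trans (∑-comm (λ u v → ∑[ w < n ] f v w u)) (sum-cong-≗ λ v → ∑-comm (λ u w → f v w u))

  ∑³-∑-comm : ∀ {p} (f : Fin p → Fin n → Fin n → Fin n → ℕ) →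
              ∑³ (λ u v w → ∑[ i < p ] f i u v w) ≡ ∑[ i < p ] ∑³ (f i)
  ∑³-∑-comm {p} f = trans
    (sum-cong-≗ λ u → trans
      (sum-cong-≗ λ v → ∑-comm (λ w i → f i u v w))
      (∑-comm (λ v i → sum (f i u v))))
    (∑-comm (λ u i → ∑[ v < n ] sum (f i u v)))

-- Double counting of triangles and monochromatic cherries.

-- X i is the adjacency matrix of the retained edges of colour i, and K i is their number.
module Counting {n p : ℕ} (X : Fin p → Fin n → Fin n → ℕ) (K : Fin p → ℕ) where

  A : Fin n → Fin n → ℕ
  A u v = ∑[ i < p ] X i u v

  degree : Fin p → Fin n → ℕ
  degree i u = ∑[ v < n ] X i u v

  module _
    (X-sym         : ∀ i u v → X i u v ≡ X i v u)
    (X-total       : ∀ i → ∑[ u < n ] degree i u ≡ 2 * K i)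
    -- A star attains this value: its centre contributes the square of `K i` and each of its `K i`
    -- leaves contributes 1.
    (X-squares     : ∀ i → ∑[ u < n ] (degree i u * degree i u) ≤ K i * K i + K i)
    -- Two facts in one: the entries of `A` are 0 or 1, and its diagonal vanishes.
    (A+δ≤1         : ∀ u v → A u v + δ u v ≤ 1)
    (not-rainbow   : ∀ {u v w i j l} → 0 < X i v w → 0 < X j w u → 0 < X l u v →
                     i ≡ j ⊎ j ≡ l ⊎ l ≡ i)
    where

    D : Fin n → ℕ
    D u = ∑[ v < n ] A u v

    -- `Q` is the number m of retained edges, `M` counts each of them from both ends, and `T` counts
    -- each triangle six times, as an ordered triple.
    M ∑D² T Q : ℕ
    M  = ∑[ u < n ] D u
    ∑D² = ∑[ u < n ] (D u * D u)
    T  = ∑³ λ u v w → A u v * A v w * A w u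
    Q  = ∑[ i < p ] K i

    A-sym : ∀ u v → A u v ≡ A v u
    A-sym u v = sum-cong-≗ λ i → X-sym i u v

    A≤1 : ∀ u v → A u v ≤ 1
    A≤1 u v = ≤-trans (m≤m+n _ _) (A+δ≤1 u v)

    M≡2Q : M ≡ 2 * Q
    M≡2Q = begin
      ∑[ u < n ] ∑[ v < n ] ∑[ i < p ] X i u v ≡⟨ sum-cong-≗ (λ u → ∑-comm (λ v i → X i u v)) ⟩
      ∑[ u < n ] ∑[ i < p ] degree i u         ≡⟨ ∑-comm (λ u i → degree i u) ⟩
      ∑[ i < p ] ∑[ u < n ] degree i u         ≡⟨ sum-cong-≗ X-total ⟩
      ∑[ i < p ] (2 * K i)                     ≡⟨ *-distribˡ-sum 2 K ⟨
      2 * Q                                    ∎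
      where open ≡-Reasoning

    -- For an ordered edge (u, v) and any w, the indicators of w ~ u and w ~ v add up to at most 1
    -- plus the indicator of both. Summed over all edges and all w, each indicator on the left gives
    -- the sum of squared degrees, while the right gives `n * M` and the triangles.
    goodman : 2 * ∑D² ≤ n * M + T
    goodman = begin
      2 * ∑D²                                                             ≡⟨ cong (∑D² +_) (+-identityʳ ∑D²) ⟩
      ∑D² + ∑D²                                                            ≡⟨ cong₂ _+_ at-u at-v ⟩
      ∑³ (λ u v w → A u v * A u w) + ∑³ (λ u v w → A u v * A v w)        ≡⟨ ∑³-distrib-+ (λ u v w → A u v * A u w) (λ u v w → A u v * A v w) ⟨
      ∑³ (λ u v w → A u v * A u w + A u v * A v w)                       ≤⟨ ∑³-mono-≤ pointwise ⟩
      ∑³ (λ u v w → A u v + A u v * A v w * A w u)                       ≡⟨ ∑³-distrib-+ (λ u v w → A u v) (λ u v w → A u v * A v w * A w u) ⟩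
      ∑³ (λ u v w → A u v) + T                                           ≡⟨ cong (_+ T) nM ⟩
      n * M + T                                                          ∎
      where
      open ≤-Reasoning

      at-u : ∑D² ≡ ∑³ (λ u v w → A u v * A u w)
      at-u = sum-cong-≗ λ u → trans (*-distribʳ-sum (D u) (A u))
        (sum-cong-≗ λ v → *-distribˡ-sum (A u v) (A u))

      at-v : ∑D² ≡ ∑³ (λ u v w → A u v * A v w)
      at-v = trans
        (sum-cong-≗ λ v → trans (*-distribʳ-sum (D v) (A v)) (sum-cong-≗ λ u →
          trans (cong (_* D v) (A-sym v u)) (*-distribˡ-sum (A u v) (A v))))
        (∑-comm (λ v u → ∑[ w < n ] (A u v * A v w)))

      pointwise : ∀ u v w → A u v * A u w + A u v * A v w ≤ A u v + A u v * A v w * A w u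
      pointwise u v w = begin
        A u v * A u w + A u v * A v w   ≡⟨ *-distribˡ-+ (A u v) _ _ ⟨
        A u v * (A u w + A v w)         ≡⟨ cong (λ b → A u v * (b + A v w)) (A-sym u w) ⟩
        A u v * (A w u + A v w)         ≤⟨ *-monoʳ-≤ (A u v) (b+c≤1+cb (A≤1 w u) (A≤1 v w)) ⟩
        A u v * (1 + A v w * A w u)     ≡⟨ *-distribˡ-+ (A u v) 1 _ ⟩
        A u v * 1 + A u v * (A v w * A w u) ≡⟨ cong₂ _+_ (*-identityʳ (A u v)) (sym (*-assoc (A u v) _ _)) ⟩
        A u v + A u v * A v w * A w u   ∎

      nM : ∑³ (λ u v w → A u v) ≡ n * M
      nM = trans
        (sum-cong-≗ λ u → trans (sum-cong-≗ λ v → sum-const n (A u v)) (sym (*-distribˡ-sum n (A u))))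
        (sym (*-distribˡ-sum n D))

    -- The path u, v, w has colour i; the side from w to u closing it may have any retained colour.
    cherries : Fin p → Fin n → Fin n → Fin n → ℕ
    cherries i u v w = X i u v * X i v w * A w u

    anyCherry : Fin n → Fin n → Fin n → ℕ
    anyCherry u v w = ∑[ i < p ] cherries i u v w

    0<A : ∀ {i u v} → 0 < X i u v → 0 < A u v
    0<A {i} {u} {v} 0<X = ≤-trans 0<X (term≤sum (λ i → X i u v) i)

    0<anyCherry : ∀ {i u v w} → 0 < X i u v → 0 < X i v w → 0 < A w u → 0 < anyCherry u v w
    0<anyCherry {i} {u} {v} {w} x y a =
      ≤-trans (*-mono-≤ (*-mono-≤ x y) a) (term≤sum (λ i → cherries i u v w) i)

    -- Two sides of a non-rainbow triangle share a colour, and they meet at v, w or u. The three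
    -- rotations of `anyCherry` cover these cases and have equal sums. A monochromatic triangle is
    -- counted more than once, which the inequality allows.
    T≤3cherries : T ≤ 3 * ∑[ i < p ] ∑³ (cherries i)
    T≤3cherries = begin
      T ≤⟨ ∑³-mono-≤ pointwise ⟩
      ∑³ (λ u v w → anyCherry u v w + (anyCherry v w u + anyCherry w u v))
        ≡⟨ ∑³-distrib-+ anyCherry (λ u v w → anyCherry v w u + anyCherry w u v) ⟩
      ∑³ anyCherry + ∑³ (λ u v w → anyCherry v w u + anyCherry w u v)
        ≡⟨ cong (∑³ anyCherry +_) (∑³-distrib-+ (λ u v w → anyCherry v w u) (λ u v w → anyCherry w u v)) ⟩
      ∑³ anyCherry + (∑³ (λ u v w → anyCherry v w u) + ∑³ (λ u v w → anyCherry w u v))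
        ≡⟨ cong₂ (λ x y → ∑³ anyCherry + (x + y)) (∑³-rotate anyCherry)
             -- Read backwards: rotating `anyCherry w u v` restores `anyCherry u v w`.
             (sym (∑³-rotate (λ u v w → anyCherry w u v))) ⟩
      ∑³ anyCherry + (∑³ anyCherry + ∑³ anyCherry)
        ≡⟨ cong (λ x → ∑³ anyCherry + (∑³ anyCherry + x)) (+-identityʳ _) ⟨
      3 * ∑³ anyCherry
        ≡⟨ cong (3 *_) (∑³-∑-comm cherries) ⟩
      3 * ∑[ i < p ] ∑³ (cherries i) ∎
      where
      open ≤-Reasoning

      pointwise : ∀ u v w → A u v * A v w * A w u ≤
                            anyCherry u v w + (anyCherry v w u + anyCherry w u v)
      -- The product is 0 or 1, so only a genuine triangle matters, and each of its sides then has a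
      -- colour.
      pointwise u v w = 0<⇒1≤⇒≤ (*-mono-≤ (*-mono-≤ (A≤1 u v) (A≤1 v w)) (A≤1 w u)) λ 0<AAA →
        let 0<AA , 0<wu = 0<m*k⇒ (A u v * A v w) 0<AAA
            0<uv , 0<vw = 0<m*k⇒ (A u v) 0<AA
            l , xl = 0<sum⇒∃ (λ l → X l u v) 0<uv
            i , xi = 0<sum⇒∃ (λ i → X i v w) 0<vw
            j , xj = 0<sum⇒∃ (λ j → X j w u) 0<wu
        in repeated xi xj xl (not-rainbow xi xj xl)
        where
        repeated : ∀ {i j l} → 0 < X i v w → 0 < X j w u → 0 < X l u v → i ≡ j ⊎ j ≡ l ⊎ l ≡ i →
                   0 < anyCherry u v w + (anyCherry v w u + anyCherry w u v)
        repeated xi xj xl (inj₁ refl) =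
          ≤-trans (0<anyCherry xi xj (0<A xl)) (≤-trans (m≤m+n _ _) (m≤n+m _ (anyCherry u v w)))
        repeated xi xj xl (inj₂ (inj₁ refl)) =
          ≤-trans (0<anyCherry xj xl (0<A xi)) (≤-trans (m≤n+m _ (anyCherry v w u)) (m≤n+m _ (anyCherry u v w)))
        repeated xi xj xl (inj₂ (inj₂ refl)) =
          ≤-trans (0<anyCherry xl xi (0<A xj)) (m≤m+n _ _)

    -- The two-step walks of colour i number at most K² + K, where K is `K i`. At least 2K of them
    -- return to their start, and these are disjoint from the cherries, whose ends are adjacent.
    -- This leaves at most K² - K cherries, stated without subtraction.
    cherries-bound : ∀ i → ∑³ (cherries i) + K i ≤ K i * K i
    cherries-bound i = +-cancelʳ-≤ (K i) _ _ (begin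
      ∑³ (cherries i) + K i + K i                  ≡⟨ +-assoc (∑³ (cherries i)) _ _ ⟩
      ∑³ (cherries i) + (K i + K i)                ≡⟨ cong (λ x → ∑³ (cherries i) + (K i + x)) (+-identityʳ (K i)) ⟨
      ∑³ (cherries i) + 2 * K i                    ≡⟨ cong (∑³ (cherries i) +_) (X-total i) ⟨
      ∑³ (cherries i) + ∑[ u < n ] degree i u      ≤⟨ +-monoʳ-≤ (∑³ (cherries i)) closed ⟩
      ∑³ (cherries i) + ∑³ (λ u v w → δ u w * (X i u v * X i v w))
                                                   ≡⟨ ∑³-distrib-+ (cherries i) (λ u v w → δ u w * (X i u v * X i v w)) ⟨
      ∑³ (λ u v w → cherries i u v w + δ u w * (X i u v * X i v w))
                                                   ≤⟨ ∑³-mono-≤ pointwise ⟩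
      ∑³ (λ u v w → X i u v * X i v w)             ≡⟨ paths ⟩
      ∑[ v < n ] (degree i v * degree i v)         ≤⟨ X-squares i ⟩
      K i * K i + K i                              ∎)
      where
      open ≤-Reasoning

      m≤m*m : ∀ m → m ≤ m * m
      m≤m*m zero    = z≤n
      m≤m*m (suc m) = m≤m*n (suc m) (suc m)

      -- Each ordered edge (u, v) gives the returning walk u, v, u.
      closed : ∑[ u < n ] degree i u ≤ ∑³ (λ u v w → δ u w * (X i u v * X i v w))
      closed = sum-mono-≤ λ u → sum-mono-≤ λ v → begin
        X i u v                                     ≤⟨ m≤m*m (X i u v) ⟩
        X i u v * X i u v                           ≡⟨ cong (X i u v *_) (X-sym i u v) ⟩
        X i u v * X i v u                           ≡⟨ ∑-δ u (λ w → X i u v * X i v w) ⟨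
        ∑[ w < n ] (δ u w * (X i u v * X i v w))    ∎

      pointwise : ∀ u v w → cherries i u v w + δ u w * (X i u v * X i v w) ≤ X i u v * X i v w
      pointwise u v w = begin
        x * A w u + δ u w * x     ≡⟨ cong₂ _+_ (cong (x *_) (A-sym w u)) (*-comm (δ u w) x) ⟩
        x * A u w + x * δ u w     ≡⟨ *-distribˡ-+ x _ _ ⟨
        x * (A u w + δ u w)       ≤⟨ *-monoʳ-≤ x (A+δ≤1 u w) ⟩
        x * 1                     ≡⟨ *-identityʳ x ⟩
        x                         ∎
        where x = X i u v * X i v w

      paths : ∑³ (λ u v w → X i u v * X i v w) ≡ ∑[ v < n ] (degree i v * degree i v)
      paths = sym (trans
        (sum-cong-≗ λ v → trans (*-distribʳ-sum (degree i v) (X i v)) (sum-cong-≗ λ u →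
          trans (cong (_* degree i v) (X-sym i v u)) (*-distribˡ-sum (X i u v) (X i v))))
        (∑-comm (λ v u → ∑[ w < n ] (X i u v * X i v w))))

    -- Cauchy-Schwarz, Goodman's inequality and the cherry count are chained, and a factor `Q` is
    -- cancelled at the end. The summand `n * (3 * Q)` is carried from the start so that it can
    -- absorb the -K in the bound on cherries.
    bound : ∀ k → (∀ i → K i ≤ k) → .{{_ : NonZero Q}} → 8 * Q + 3 * n ≤ 2 * n * n + 3 * n * k
    bound k K≤k = *-cancelʳ-≤ _ _ Q (begin
      (8 * Q + 3 * n) * Q                ≡⟨ identity₁ Q n ⟩
      2 * (2 * Q * (2 * Q)) + n * (3 * Q)  ≡⟨ cong (λ m → 2 * (m * m) + n * (3 * Q)) M≡2Q ⟨
      2 * (M * M) + n * (3 * Q)          ≤⟨ +-monoˡ-≤ _ (*-monoʳ-≤ 2 (sum²≤n*sum-squares D)) ⟩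
      2 * (n * ∑D²) + n * (3 * Q)         ≡⟨ identity₂ n ∑D² Q ⟩
      n * (2 * ∑D²) + n * (3 * Q)         ≤⟨ +-monoˡ-≤ _ (*-monoʳ-≤ n goodman) ⟩
      n * (n * M + T) + n * (3 * Q)      ≡⟨ identity₃ n M T (3 * Q) ⟩
      n * (n * M + (T + 3 * Q))          ≤⟨ *-monoʳ-≤ n (+-monoʳ-≤ (n * M) T+3Q≤3kQ) ⟩
      n * (n * M + 3 * (k * Q))          ≡⟨ cong (λ m → n * (n * m + 3 * (k * Q))) M≡2Q ⟩
      n * (n * (2 * Q) + 3 * (k * Q))    ≡⟨ identity₄ n k Q ⟩
      (2 * n * n + 3 * n * k) * Q        ∎)
      where
      open ≤-Reasoning

      identity₁ : ∀ Q n → (8 * Q + 3 * n) * Q ≡ 2 * (2 * Q * (2 * Q)) + n * (3 * Q)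
      identity₁ = solve-∀

      identity₂ : ∀ n ∑D² Q → 2 * (n * ∑D²) + n * (3 * Q) ≡ n * (2 * ∑D²) + n * (3 * Q)
      identity₂ = solve-∀

      identity₃ : ∀ n M T q → n * (n * M + T) + n * q ≡ n * (n * M + (T + q))
      identity₃ = solve-∀

      identity₄ : ∀ n k Q → n * (n * (2 * Q) + 3 * (k * Q)) ≡ (2 * n * n + 3 * n * k) * Q
      identity₄ = solve-∀

      T+3Q≤3kQ : T + 3 * Q ≤ 3 * (k * Q)
      T+3Q≤3kQ = begin
        T + 3 * Q                                    ≤⟨ +-monoˡ-≤ (3 * Q) T≤3cherries ⟩
        3 * ∑[ i < p ] ∑³ (cherries i) + 3 * Q       ≡⟨ *-distribˡ-+ 3 (∑[ i < p ] ∑³ (cherries i)) Q ⟨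
        3 * (∑[ i < p ] ∑³ (cherries i) + Q)         ≡⟨ cong (3 *_) (∑-distrib-+ (λ i → ∑³ (cherries i)) K) ⟨
        3 * ∑[ i < p ] (∑³ (cherries i) + K i)       ≤⟨ *-monoʳ-≤ 3 (sum-mono-≤ λ i → ≤-trans (cherries-bound i) (*-monoˡ-≤ (K i) (K≤k i))) ⟩
        3 * ∑[ i < p ] (k * K i)                     ≡⟨ cong (3 *_) (*-distribˡ-sum k K) ⟨
        3 * (k * Q)                                  ∎

-- Rainbow triangles as subgraphs, built from three coloured edges.

-- The corner opposite the side {a , b}; the value for a = b is irrelevant.
third : Fin 3 → Fin 3 → Fin 3
third 0F 1F = 2F
third 0F 2F = 1F
third 1F 0F = 2F
third 1F 2F = 0F
third 2F 0F = 1F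
third 2F 1F = 0F
third a  _  = a

-- Decided by running through all 81 quadruples. Both orders must be allowed in the conclusion,
-- since `third` is symmetric on distinct arguments.
third-injective : ∀ a b a′ b′ → a ≢ b → a′ ≢ b′ → third a b ≡ third a′ b′ →
                  (a ≡ a′ × b ≡ b′) ⊎ (a ≡ b′ × b ≡ a′)
third-injective = from-yes
  (Fin.all? λ a → Fin.all? λ b → Fin.all? λ a′ → Fin.all? λ b′ →
    ¬? (a Fin.≟ b) →-dec ¬? (a′ Fin.≟ b′) →-dec (third a b Fin.≟ third a′ b′) →-dec
    (((a Fin.≟ a′) ×-dec (b Fin.≟ b′)) ⊎-dec ((a Fin.≟ b′) ×-dec (b Fin.≟ a′))))

module _ {n} (G : EdgeColouredGraph n) where
  open EdgeColouredGraph G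
  open Graph graph

  -- The classes hold each edge only as its increasing pair; this is their symmetric closure.
  Joined : Fin p → Fin n → Fin n → Set
  Joined i u v = C i (u , v) ⊎ C i (v , u)

  Joined-sym : ∀ {i u v} → Joined i u v → Joined i v u
  Joined-sym (inj₁ x) = inj₂ x
  Joined-sym (inj₂ x) = inj₁ x

  Joined⇒~ : ∀ {i u v} → Joined i u v → u ~ v
  Joined⇒~ (inj₁ x) = proj₂ (C⊆E _ x)
  Joined⇒~ (inj₂ x) = ~-sym (proj₂ (C⊆E _ x))

  Joined-irrefl : ∀ {i u v} → Joined i u v → u ≢ v
  Joined-irrefl x u≡v = ~-irrefl u≡v (Joined⇒~ x)

  Joined-unique : ∀ {i j u v} → Joined i u v → Joined j u v → i ≡ j
  Joined-unique (inj₁ x) (inj₁ y) = disjoint x y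
  -- Opposite orientations would give both u < v and v < u.
  Joined-unique (inj₁ x) (inj₂ y) = contradiction (proj₁ (C⊆E _ y)) (Fin.<-asym (proj₁ (C⊆E _ x)))
  Joined-unique (inj₂ x) (inj₁ y) = contradiction (proj₁ (C⊆E _ y)) (Fin.<-asym (proj₁ (C⊆E _ x)))
  Joined-unique (inj₂ x) (inj₂ y) = disjoint x y

  -- Sides are indexed by their opposite corners: `c s` is the colour of the side facing `t s`. One
  -- formula then describes all three sides in both directions.
  module Triangle
    (t : Fin 3 → Fin n) (c : Fin 3 → Fin p) (c-injective : Injective _≡_ _≡_ c)
    (joined : ∀ {a b} → a ≢ b → Joined (c (third a b)) (t a) (t b))
    where

    t-injective : Injective _≡_ _≡_ t
    t-injective {a} {b} ta≡tb = decidable-stable (a Fin.≟ b) λ a≢b → Joined-irrefl (joined a≢b) ta≡tb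

    corners : Subset n
    corners = ⁅ t 0F ⁆ ∪ (⁅ t 1F ⁆ ∪ ⁅ t 2F ⁆)

    ∈-corners⁺ : ∀ s → t s ∈ corners
    ∈-corners⁺ 0F = x∈p∪q⁺ (inj₁ (x∈⁅x⁆ _))
    ∈-corners⁺ 1F = x∈p∪q⁺ (inj₂ (x∈p∪q⁺ (inj₁ (x∈⁅x⁆ _))))
    ∈-corners⁺ 2F = x∈p∪q⁺ (inj₂ (x∈p∪q⁺ (inj₂ (x∈⁅x⁆ _))))

    ∈-corners⁻ : ∀ {x} → x ∈ corners → ∃ λ s → t s ≡ x
    ∈-corners⁻ x∈ with x∈p∪q⁻ ⁅ t 0F ⁆ _ x∈
    ... | inj₁ x∈₀ = 0F , sym (x∈⁅y⁆⇒x≡y _ x∈₀)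
    ... | inj₂ x∈₁₂ with x∈p∪q⁻ ⁅ t 1F ⁆ _ x∈₁₂
    ...   | inj₁ x∈₁ = 1F , sym (x∈⁅y⁆⇒x≡y _ x∈₁)
    ...   | inj₂ x∈₂ = 2F , sym (x∈⁅y⁆⇒x≡y _ x∈₂)

    sides : Graph (Fin n)
    sides = record
      { _~_      = λ x y → x ≢ y × x ∈ corners × y ∈ corners
      ; ~-sym    = λ (x≢y , x∈ , y∈) → x≢y ∘ sym , y∈ , x∈
      ; ~-irrefl = λ x≡y (x≢y , _) → x≢y x≡y
      ; _~?_     = λ x y → ¬? (x Fin.≟ y) ×-dec (x ∈? corners) ×-dec (y ∈? corners)
      }

    side-joined : ∀ {x y} → Graph._~_ sides x y →
                  ∃ λ a → ∃ λ b → a ≢ b × t a ≡ x × t b ≡ y × Joined (c (third a b)) x y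
    side-joined (x≢y , x∈ , y∈) with ∈-corners⁻ x∈ | ∈-corners⁻ y∈
    ... | a , refl | b , refl = a , b , a≢b , refl , refl , joined a≢b
      where a≢b = x≢y ∘ cong t

    triangle : Subgraph graph
    triangle = record
      { vertices  = corners
      ; edges     = sides
      ; endpoints = λ (_ , x∈ , _) → x∈
      ; edges⊆    = λ x~y → let _ , _ , _ , _ , _ , j = side-joined x~y in Joined⇒~ j
      }

    isTriangle : IsTriangle triangle
    isTriangle = record
      { bijection = mk↔ₛ′ index (λ s → t s , ∈-corners⁺ s)
          (λ s → t-injective (proj₂ (∈-corners⁻ (∈-corners⁺ s))))
          from-index
      ; adjacency = λ (x , x∈) (y , y∈) → mk⇔
          (λ (x≢y , _) ix≡iy → x≢y
            (trans (sym (proj₂ (∈-corners⁻ x∈))) (trans (cong t ix≡iy) (proj₂ (∈-corners⁻ y∈)))))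
          (λ ix≢iy → (λ { x≡y → ix≢iy (t-injective
            (trans (proj₂ (∈-corners⁻ x∈)) (trans x≡y (sym (proj₂ (∈-corners⁻ y∈)))))) }) , x∈ , y∈)
      }
      where
      index : (∃ λ v → v ∈ corners) → Fin 3
      index (_ , x∈) = proj₁ (∈-corners⁻ x∈)

      from-index : ∀ x → (t (index x) , ∈-corners⁺ (index x)) ≡ x
      from-index (x , x∈) with ∈-corners⁻ x∈
      -- Membership proofs are unique, so the vertex alone determines the pair.
      ... | s , refl = cong (t s ,_) ([]=-irrelevant _ _)

    -- Two edges of equal colour face the same corner, so they have the same ends. Distinctness
    -- rules out equal orientation, and the convention u < v rules out opposite ones.
    isRainbow : IsRainbow G triangle
    isRainbow (x<y , x~y) (x′<y′ , x′~y′) e≢f Ce Cf refl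
      with side-joined x~y | side-joined x′~y′
    ... | a , b , a≢b , refl , refl , j | a′ , b′ , a′≢b′ , refl , refl , j′
      with third-injective a b a′ b′ a≢b a′≢b′
             (c-injective (trans (Joined-unique j (inj₁ Ce)) (Joined-unique (inj₁ Cf) j′)))
    ...   | inj₁ (refl , refl) = e≢f refl
    ...   | inj₂ (refl , refl) = Fin.<-asym x<y x′<y′

    hasRainbowTriangle : HasRainbowTriangle G
    hasRainbowTriangle = triangle , isTriangle , isRainbow

  -- A form open to finite search; the colours i, j, l face u, v, w respectively.
  RainbowTriple : Set
  RainbowTriple = ∃ λ u → ∃ λ v → ∃ λ w → ∃ λ i → ∃ λ j → ∃ λ l →
    Joined i v w × Joined j w u × Joined l u v × i ≢ j × j ≢ l × l ≢ i

  RainbowTriple⇒HasRainbowTriangle : RainbowTriple → HasRainbowTriangle G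
  RainbowTriple⇒HasRainbowTriangle (u , v , w , i , j , l , vw , wu , uv , i≢j , j≢l , l≢i) =
    Triangle.hasRainbowTriangle t c c-injective joined
    where
    t : Fin 3 → Fin n
    t 0F = u
    t 1F = v
    t 2F = w

    c : Fin 3 → Fin p
    c 0F = i
    c 1F = j
    c 2F = l

    c-injective : Injective _≡_ _≡_ c
    c-injective {0F} {0F} _ = refl
    c-injective {0F} {1F} e = contradiction e i≢j
    c-injective {0F} {2F} e = contradiction (sym e) l≢i
    c-injective {1F} {0F} e = contradiction (sym e) i≢j
    c-injective {1F} {1F} _ = refl
    c-injective {1F} {2F} e = contradiction e j≢l
    c-injective {2F} {0F} e = contradiction e l≢i
    c-injective {2F} {1F} e = contradiction (sym e) j≢l
    c-injective {2F} {2F} _ = refl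

    joined : ∀ {a b} → a ≢ b → Joined (c (third a b)) (t a) (t b)
    joined {0F} {0F} a≢a = contradiction refl a≢a
    joined {0F} {1F} _   = uv
    joined {0F} {2F} _   = Joined-sym wu
    joined {1F} {0F} _   = Joined-sym uv
    joined {1F} {1F} a≢a = contradiction refl a≢a
    joined {1F} {2F} _   = vw
    joined {2F} {0F} _   = wu
    joined {2F} {1F} _   = Joined-sym vw
    joined {2F} {2F} a≢a = contradiction refl a≢a

-- Trimming the colour classes and verifying the counting hypotheses.

module _ {n} (G : EdgeColouredGraph n) where
  open EdgeColouredGraph G

  -- Decidability makes the later argument by contradiction constructive.
  rainbowTriple? : Dec (RainbowTriple G)
  rainbowTriple? = Fin.any? λ u → Fin.any? λ v → Fin.any? λ w →
    Fin.any? λ i → Fin.any? λ j → Fin.any? λ l →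
    joined? i v w ×-dec joined? j w u ×-dec joined? l u v ×-dec
    ¬? (i Fin.≟ j) ×-dec ¬? (j Fin.≟ l) ×-dec ¬? (l Fin.≟ i)
    where
    joined? : ∀ i u v → Dec (Joined G i u v)
    joined? i u v = C? i (u , v) ⊎-dec C? i (v , u)

  -- e i enumerates the retained edges of colour i.
  module Trimmed (K : Fin p → ℕ) (e : ∀ i → Fin (K i) → Fin n × Fin n)
                 (e-injective : ∀ i → Injective _≡_ _≡_ (e i))
                 (e∈C : ∀ i j → C i (e i j)) where

    private
      a b : ∀ i → Fin (K i) → Fin n
      a i j = proj₁ (e i j)
      b i j = proj₂ (e i j)

    a<b : ∀ i j → a i j Fin.< b i j
    a<b i j = proj₁ (C⊆E i (e∈C i j))

    a≢b : ∀ i j → a i j ≢ b i j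
    a≢b i j = Fin.<⇒≢ (a<b i j)

    inc : ∀ i → Fin (K i) → Fin n → ℕ
    inc i j u = δ (a i j) u + δ (b i j) u

    -- The indicator that the edge `e i j` has ends u and v. The factor in v stands first so that
    -- `∑-δ` applies when summing over v.
    joins : ∀ i → Fin (K i) → Fin n → Fin n → ℕ
    joins i j u v = δ (b i j) v * δ (a i j) u + δ (a i j) v * δ (b i j) u

    X : Fin p → Fin n → Fin n → ℕ
    X i u v = ∑[ j < K i ] joins i j u v

    open Counting X K using (A; degree; bound)

    joins-sym : ∀ i j u v → joins i j u v ≡ joins i j v u
    joins-sym i j u v = trans (+-comm (δ (b i j) v * δ (a i j) u) _)
      (cong₂ _+_ (*-comm (δ (a i j) v) _) (*-comm (δ (b i j) v) _))

    X-sym : ∀ i u v → X i u v ≡ X i v u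
    X-sym i u v = sum-cong-≗ λ j → joins-sym i j u v

    degree≡ : ∀ i u → degree i u ≡ ∑[ j < K i ] inc i j u
    degree≡ i u = trans (∑-comm (λ v j → joins i j u v)) (sum-cong-≗ λ j → trans
      (∑-distrib-+ (λ v → δ (b i j) v * δ (a i j) u) (λ v → δ (a i j) v * δ (b i j) u))
      (cong₂ _+_ (∑-δ (b i j) (λ _ → δ (a i j) u)) (∑-δ (a i j) (λ _ → δ (b i j) u))))

    -- Weighted handshaking: every edge passes on the weight of each of its two ends. The weight 1
    -- gives `X-total`, and the weight `degree i` gives the sum of squares.
    sum-degree : ∀ i (f : Fin n → ℕ) →
                 ∑[ u < n ] (degree i u * f u) ≡ ∑[ j < K i ] (f (a i j) + f (b i j))
    sum-degree i f = begin
      ∑[ u < n ] (degree i u * f u)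
        ≡⟨ sum-cong-≗ (λ u → trans (cong (_* f u) (degree≡ i u)) (*-distribʳ-sum (f u) (λ j → inc i j u))) ⟩
      ∑[ u < n ] ∑[ j < K i ] (inc i j u * f u)
        ≡⟨ ∑-comm (λ u j → inc i j u * f u) ⟩
      ∑[ j < K i ] ∑[ u < n ] (inc i j u * f u)
        ≡⟨ sum-cong-≗ (λ j → trans
             (sum-cong-≗ λ u → *-distribʳ-+ (f u) (δ (a i j) u) (δ (b i j) u))
             (trans (∑-distrib-+ (λ u → δ (a i j) u * f u) (λ u → δ (b i j) u * f u))
                    (cong₂ _+_ (∑-δ (a i j) f) (∑-δ (b i j) f)))) ⟩
      ∑[ j < K i ] (f (a i j) + f (b i j)) ∎
      where open ≡-Reasoning

    X-total : ∀ i → ∑[ u < n ] degree i u ≡ 2 * K i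
    X-total i = begin
      ∑[ u < n ] degree i u         ≡⟨ sum-cong-≗ (λ u → *-identityʳ (degree i u)) ⟨
      ∑[ u < n ] (degree i u * 1)   ≡⟨ sum-degree i (λ _ → 1) ⟩
      ∑[ j < K i ] 2                ≡⟨ sum-const (K i) 2 ⟩
      K i * 2                       ≡⟨ *-comm (K i) 2 ⟩
      2 * K i                       ∎
      where open ≡-Reasoning

    inc≤1 : ∀ i j u → inc i j u ≤ 1
    inc≤1 i j u = exclusive (δ≤1 (a i j) u) (δ≤1 (b i j) u) λ 0<δa 0<δb →
      a≢b i j (trans (0<δ⇒≡ 0<δa) (sym (0<δ⇒≡ 0<δb)))

    0<inc⇒ : ∀ i j u → 0 < inc i j u → a i j ≡ u ⊎ b i j ≡ u
    0<inc⇒ i j u 0<inc with 0<m+k⇒ (δ (a i j) u) 0<inc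
    ... | inj₁ 0<δa = inj₁ (0<δ⇒≡ 0<δa)
    ... | inj₂ 0<δb = inj₂ (0<δ⇒≡ 0<δb)

    -- Distinct edges share at most one vertex.
    common-ends : ∀ i j l → inc i l (a i j) + inc i l (b i j) ≤ 1 + δ j l
    common-ends i j l with j Fin.≟ l
    ... | yes refl = subst (λ m → inc i j (a i j) + inc i j (b i j) ≤ 1 + m) (sym (δ-refl j))
                       (+-mono-≤ (inc≤1 i j (a i j)) (inc≤1 i j (b i j)))
    ... | no  j≢l = ≤-trans
      (exclusive (inc≤1 i l (a i j)) (inc≤1 i l (b i j)) λ 0<inca 0<incb →
        both (0<inc⇒ i l (a i j) 0<inca) (0<inc⇒ i l (b i j) 0<incb))
      (m≤m+n 1 _)
      where
      both : a i l ≡ a i j ⊎ b i l ≡ a i j → ¬ (a i l ≡ b i j ⊎ b i l ≡ b i j)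
      both (inj₁ aa) (inj₁ ab) = a≢b i j (trans (sym aa) ab)
      both (inj₁ aa) (inj₂ bb) = j≢l (sym (e-injective i (cong₂ _,_ aa bb)))
      -- The same two ends in swapped roles contradict the increasing order within each pair.
      both (inj₂ ba) (inj₁ ab) = Fin.<-asym (a<b i j) (subst₂ Fin._<_ ab ba (a<b i l))
      both (inj₂ ba) (inj₂ bb) = a≢b i j (trans (sym ba) bb)

    -- The sum of squares counts common ends over ordered pairs of edges: at most 1 for every pair,
    -- and one more when the two edges coincide.
    X-squares : ∀ i → ∑[ u < n ] (degree i u * degree i u) ≤ K i * K i + K i
    X-squares i = begin
      ∑[ u < n ] (degree i u * degree i u)
        ≡⟨ sum-degree i (degree i) ⟩
      ∑[ j < K i ] (degree i (a i j) + degree i (b i j))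
        ≡⟨ sum-cong-≗ (λ j → trans (cong₂ _+_ (degree≡ i (a i j)) (degree≡ i (b i j)))
             (sym (∑-distrib-+ (λ l → inc i l (a i j)) (λ l → inc i l (b i j))))) ⟩
      ∑[ j < K i ] ∑[ l < K i ] (inc i l (a i j) + inc i l (b i j))
        ≤⟨ sum-mono-≤ (λ j → sum-mono-≤ λ l → common-ends i j l) ⟩
      ∑[ j < K i ] ∑[ l < K i ] (1 + δ j l)
        ≡⟨ sum-cong-≗ (λ j → trans (∑-distrib-+ {K i} (λ _ → 1) (δ j))
             (cong₂ _+_ (sum-const (K i) 1)
               (trans (sum-cong-≗ λ l → sym (*-identityʳ (δ j l))) (∑-δ j (λ _ → 1))))) ⟩
      ∑[ j < K i ] (K i * 1 + 1)
        ≡⟨ sum-const (K i) (K i * 1 + 1) ⟩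
      K i * (K i * 1 + 1)
        ≡⟨ identity (K i) ⟩
      K i * K i + K i ∎
      where
      open ≤-Reasoning

      identity : ∀ k → k * (k * 1 + 1) ≡ k * k + k
      identity = solve-∀

    0<joins⇒ : ∀ i j u v → 0 < joins i j u v → e i j ≡ (u , v) ⊎ e i j ≡ (v , u)
    0<joins⇒ i j u v 0<joins with 0<m+k⇒ (δ (b i j) v * δ (a i j) u) 0<joins
    ... | inj₁ 0<δδ = let 0<δb , 0<δa = 0<m*k⇒ (δ (b i j) v) 0<δδ
                      in inj₁ (cong₂ _,_ (0<δ⇒≡ 0<δa) (0<δ⇒≡ 0<δb))
    ... | inj₂ 0<δδ = let 0<δa , 0<δb = 0<m*k⇒ (δ (a i j) v) 0<δδ
                      in inj₂ (cong₂ _,_ (0<δ⇒≡ 0<δa) (0<δ⇒≡ 0<δb))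

    joins≤1 : ∀ i j u v → joins i j u v ≤ 1
    joins≤1 i j u v = exclusive
      (*-mono-≤ (δ≤1 (b i j) v) (δ≤1 (a i j) u)) (*-mono-≤ (δ≤1 (a i j) v) (δ≤1 (b i j) u))
      λ 0<δδ 0<δδ′ → a≢b i j (trans
        (0<δ⇒≡ (proj₁ (0<m*k⇒ (δ (a i j) v) 0<δδ′)))
        (sym (0<δ⇒≡ (proj₁ (0<m*k⇒ (δ (b i j) v) 0<δδ)))))

    0<X⇒Joined : ∀ i u v → 0 < X i u v → Joined G i u v
    0<X⇒Joined i u v 0<X with 0<sum⇒∃ (λ j → joins i j u v) 0<X
    ... | j , 0<joins with 0<joins⇒ i j u v 0<joins
    ...   | inj₁ e≡uv = inj₁ (subst (C i) e≡uv (e∈C i j))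
    ...   | inj₂ e≡vu = inj₂ (subst (C i) e≡vu (e∈C i j))

    -- Two retained edges of colour i with ends u and v are oriented alike, hence equal as pairs,
    -- hence have the same index.
    X≤1 : ∀ i u v → X i u v ≤ 1
    X≤1 i u v = sum≤1 (λ j → joins i j u v) (λ j → joins≤1 i j u v) λ j l 0<j 0<l →
      e-injective i (same j l (0<joins⇒ i j u v 0<j) (0<joins⇒ i l u v 0<l))
      where
      same : ∀ j l → e i j ≡ (u , v) ⊎ e i j ≡ (v , u) → e i l ≡ (u , v) ⊎ e i l ≡ (v , u) →
             e i j ≡ e i l
      same j l (inj₁ p) (inj₁ q) = trans p (sym q)
      same j l (inj₂ p) (inj₂ q) = trans p (sym q)
      same j l (inj₁ p) (inj₂ q) = contradiction
        (subst (λ (x , y) → x Fin.< y) q (a<b i l))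
        (Fin.<-asym (subst (λ (x , y) → x Fin.< y) p (a<b i j)))
      same j l (inj₂ p) (inj₁ q) = contradiction
        (subst (λ (x , y) → x Fin.< y) q (a<b i l))
        (Fin.<-asym (subst (λ (x , y) → x Fin.< y) p (a<b i j)))

    A+δ≤1 : ∀ u v → A u v + δ u v ≤ 1
    A+δ≤1 u v = exclusive
      (sum≤1 (λ i → X i u v) (λ i → X≤1 i u v) λ i j 0<i 0<j →
        Joined-unique G (0<X⇒Joined i u v 0<i) (0<X⇒Joined j u v 0<j))
      (δ≤1 u v)
      λ 0<A 0<δ → let i , 0<X = 0<sum⇒∃ (λ i → X i u v) 0<A
                  in Joined-irrefl G (0<X⇒Joined i u v 0<X) (0<δ⇒≡ 0<δ)

    no-rainbow⇒bound : ¬ RainbowTriple G → ∀ k → (∀ i → K i ≤ k) → .{{_ : NonZero (sum K)}} →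
                       8 * sum K + 3 * n ≤ 2 * n * n + 3 * n * k
    no-rainbow⇒bound ¬rt = bound X-sym X-total X-squares A+δ≤1 not-rainbow
      where
      not-rainbow : ∀ {u v w i j l} → 0 < X i v w → 0 < X j w u → 0 < X l u v →
                    i ≡ j ⊎ j ≡ l ⊎ l ≡ i
      not-rainbow {u} {v} {w} {i} {j} {l} xi xj xl with i Fin.≟ j | j Fin.≟ l | l Fin.≟ i
      ... | yes i≡j | _       | _       = inj₁ i≡j
      ... | _       | yes j≡l | _       = inj₂ (inj₁ j≡l)
      ... | _       | _       | yes l≡i = inj₂ (inj₂ l≡i)
      ... | no i≢j  | no j≢l  | no l≢i  = contradiction
        (u , v , w , i , j , l , 0<X⇒Joined i v w xi , 0<X⇒Joined j w u xj , 0<X⇒Joined l u v xl ,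
         i≢j , j≢l , l≢i) ¬rt

  -- Comparison of the bounds and the two numerical conditions.

  large-classes⇒RainbowTriple : .{{_ : NonZero n}} → (I : Subset p) (k : ℕ) →
    (∀ i → i ∈ I → k ≤ size i) → 2 * n * n + 3 * n * k ≤ 8 * (∣ I ∣ * k) → RainbowTriple G
  large-classes⇒RainbowTriple I k large many with rainbowTriple?
  ... | yes rt = rt
  ... | no ¬rt = contradiction (≤-trans upper many) (<⇒≱ strict)
    where
    K : Fin p → ℕ
    K i = if lookup I i then k else 0

    K≤k : ∀ i → K i ≤ k
    K≤k i with lookup I i
    ... | true  = ≤-refl
    ... | false = z≤n

    K≤size : ∀ i → K i ≤ size i
    K≤size i with lookup I i in eq
    ... | true  = large i (lookup⇒[]= i I eq)
    ... | false = z≤n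

    pairs : List (Fin n × Fin n)
    pairs = cartesianProduct (allFin n) (allFin n)

    e : ∀ i → Fin (K i) → Fin n × Fin n
    -- `inject≤` selects the first `K i` edges in the list of class i.
    e i j = List.lookup (filter (C? i) pairs) (inject≤ j (K≤size i))

    e-injective : ∀ i → Injective _≡_ _≡_ (e i)
    e-injective i eq = Fin.inject≤-injective (K≤size i) (K≤size i) _ _
      (lookup-injective (Unique.filter⁺ (C? i) (Unique.cartesianProduct⁺ (Unique.allFin⁺ n) (Unique.allFin⁺ n))) eq)

    e∈C : ∀ i j → C i (e i j)
    e∈C i j = proj₂ (∈-filter⁻ (C? i) {xs = pairs} (∈-lookup (inject≤ j (K≤size i))))

    0<n : 0 < n
    0<n = >-nonZero⁻¹ n

    0<Ik : 0 < ∣ I ∣ * k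
    -- The left side of `many` is at least 2n², which is positive. The total number of retained
    -- edges is therefore nonzero, as cancelling it in `bound` requires.
    0<Ik = *-cancelˡ-< 8 0 _ (≤-trans (≤-trans (*-mono-≤ (*-mono-≤ (s≤s (z≤n {1})) 0<n) 0<n) (m≤m+n (2 * n * n) _)) many)

    upper : 8 * (∣ I ∣ * k) + 3 * n ≤ 2 * n * n + 3 * n * k
    upper = subst (λ q → 8 * q + 3 * n ≤ 2 * n * n + 3 * n * k) (sum-indicator I k)
      (Trimmed.no-rainbow⇒bound K e e-injective e∈C ¬rt k K≤k
        {{>-nonZero (subst (0 <_) (sym (sum-indicator I k)) 0<Ik)}})

    strict : 8 * (∣ I ∣ * k) < 8 * (∣ I ∣ * k) + 3 * n
    strict = m<m+n (8 * (∣ I ∣ * k)) (*-mono-≤ (s≤s (z≤n {2})) 0<n)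

-- Replacing one factor n of 2n² by 3k brings the left side to 9nk, which is where the ratio 9/8
-- comes from.
enough-classes₁ : ∀ n k q → 1 * n ≤ 3 * k → 9 * n ≤ 8 * q → 2 * n * n + 3 * n * k ≤ 8 * (q * k)
enough-classes₁ n k q n≤3k 9n≤8q = begin
  2 * n * n + 3 * n * k              ≡⟨ cong (λ m → 2 * n * m + 3 * n * k) (*-identityˡ n) ⟨
  2 * n * (1 * n) + 3 * n * k        ≤⟨ +-monoˡ-≤ _ (*-monoʳ-≤ (2 * n) n≤3k) ⟩
  2 * n * (3 * k) + 3 * n * k        ≡⟨ identity n k ⟩
  9 * n * k                          ≤⟨ *-monoˡ-≤ k 9n≤8q ⟩
  8 * q * k                          ≡⟨ *-assoc 8 q k ⟩
  8 * (q * k)                        ∎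
  where
  open ≤-Reasoning
  identity : ∀ n k → 2 * n * (3 * k) + 3 * n * k ≡ 9 * n * k
  identity = solve-∀

-- Replacing 2n by 5k brings the left side to 8nk, so n classes suffice.
enough-classes₂ : ∀ n k q → 2 * n ≤ 5 * k → 1 * n ≤ 1 * q → 2 * n * n + 3 * n * k ≤ 8 * (q * k)
enough-classes₂ n k q 2n≤5k n≤q = begin
  2 * n * n + 3 * n * k              ≤⟨ +-monoˡ-≤ _ (*-monoˡ-≤ n 2n≤5k) ⟩
  5 * k * n + 3 * n * k              ≡⟨ identity n k ⟩
  8 * k * (1 * n)                    ≤⟨ *-monoʳ-≤ (8 * k) n≤q ⟩
  8 * k * (1 * q)                    ≡⟨ identity′ k q ⟩
  8 * (q * k)                        ∎
  where
  open ≤-Reasoning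
  identity : ∀ n k → 5 * k * n + 3 * n * k ≡ 8 * k * (1 * n)
  identity = solve-∀
  identity′ : ∀ k q → 8 * k * (1 * q) ≡ 8 * (q * k)
  identity′ = solve-∀

theorem2p1 : (n : ℕ) .{{_ : NonZero n}} (G : EdgeColouredGraph n) →
    ManyLargeClasses G 9 8 1 3 ⊎ ManyLargeClasses G 1 1 2 5 → HasRainbowTriangle G
theorem2p1 n G h = RainbowTriple⇒HasRainbowTriangle G (rainbowTriple h)
  where
  rainbowTriple : ManyLargeClasses G 9 8 1 3 ⊎ ManyLargeClasses G 1 1 2 5 → RainbowTriple G
  rainbowTriple (inj₁ (I , many , large)) =
    let k , n≤3k , least = ceiling 3 (1 * n)
    -- Sizes are integers, so a class of size at least n/3 has at least k edges.
    in large-classes⇒RainbowTriple G I k (λ i i∈I → least _ (large i i∈I))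
         (enough-classes₁ n k ∣ I ∣ n≤3k many)
  rainbowTriple (inj₂ (I , many , large)) =
    let k , 2n≤5k , least = ceiling 5 (2 * n)
    in large-classes⇒RainbowTriple G I k (λ i i∈I → least _ (large i i∈I))
         (enough-classes₂ n k ∣ I ∣ 2n≤5k many)
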